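{- Let $P_n$ be the path on $n\ge 2$ vertices and let $N_{\rm esp}(P_n)$ be the number of end super dominating sets of $P_n$ of minimum cardinality. Then, writing $n$ in terms of an integer $k\ge 0$, $$N_{\rm esp}(P_n)=\begin{cases}1 & \text{if } n=4k,\\ 2k+1 & \text{if } n=4k+1,\\ \dfrac{5k^2+5k+2}{2} & \text{if } n=4k+2,\\ k+1 & \text{if } n=4k+3.\end{cases}$$
   Context: Graphs are finite, simple and undirected. For a graph $G=(V,E)$ and $S\subseteq V$, write $\overline{S}=V\setminus S$, and let $N(v)$ be the open neighbourhood of $v$. A set $S \subseteq V$ is an end super dominating set (ESD-set) of $G$ if for every $u\in\overline{S}$ there exists $v\in S$ with $N(v)\cap\overline{S}=\{u\}$, and moreover $\deg(u)\ge 2$ for every $u\in\overline{S}$. The end super domination number $\gamma_{\rm esp}(G)$ is the minimum cardinality of an ESD-set of $G$, and $N_{\rm esp}(G)$ is the number of distinct ESD-sets $S\subseteq V$ of $G$ with $|S|=\gamma_{\rm esp}(G)$ (counted as subsets of the labelled vertex set, not up to symmetry). -}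

module Defs where

import Data.Bool.Properties as Bool
open import Data.Fin using (Fin; toℕ)
open import Data.Fin.Properties using (all?; any?)
open import Data.Fin.Subset using (Subset; inside; outside; _∈_; ∁; _∩_; ⁅_⁆; ∣_∣; ⊤)
open import Data.Fin.Subset.Properties using (_∈?_; ∈⊤; x∈∁p⇒x∉p; ∣⊤∣≡n)
open import Data.List using (List; []; _∷_; _++_; map; filter; length)
open import Data.List.Extrema.Nat using (min; argmin-sel; min≤v⁺)
open import Data.List.Membership.Propositional using () renaming (_∈_ to _∈ₗ_)
open import Data.List.Membership.Propositional.Properties
  using (∈-++⁺ˡ; ∈-++⁺ʳ; ∈-map⁺; ∈-map⁻; ∈-filter⁺; ∈-filter⁻)
import Data.List.Relation.Unary.All as All
import Data.List.Relation.Unary.Any as Any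
import Data.List.Relation.Unary.AllPairs as AllPairs
open import Data.List.Relation.Unary.Unique.Propositional using (Unique)
open import Data.List.Relation.Unary.Unique.Propositional.Properties using (map⁺; ++⁺)
open import Data.Nat using (ℕ; zero; suc; _≤_; _≤?_; _≟_)
open import Data.Nat.Properties using (1+n≢n; ≤-reflexive)
open import Data.Product using (_×_; _,_; ∃; proj₂)
open import Data.Sum using (_⊎_; inj₁; inj₂; swap)
open import Data.Vec using ([]; _∷_; tabulate)
open import Data.Vec.Properties using (≡-dec; ∷-injectiveʳ)
open import Function using (id)
open import Relation.Binary using (Decidable; Irreflexive; Symmetric)
open import Relation.Binary.PropositionalEquality using (_≡_; refl; sym; trans)
open import Relation.Nullary using (Dec; ¬_; does; contradiction; _×-dec_; _→-dec_; _⊎-dec_)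

record Graph (n : ℕ) : Set₁ where
  field
    Adj    : Fin n → Fin n → Set
    adj?   : Decidable Adj
    symm   : Symmetric Adj
    irrefl : Irreflexive _≡_ Adj

module _ {n : ℕ} (G : Graph n) where
  open Graph G

  N : Fin n → Subset n
  N v = tabulate (λ w → does (adj? v w))

  deg : Fin n → ℕ
  deg v = ∣ N v ∣

  IsESD : Subset n → Set
  IsESD S = ∀ u → u ∈ ∁ S →
    (∃ λ v → v ∈ S × N v ∩ ∁ S ≡ ⁅ u ⁆) × 2 ≤ deg u

  isESD? : (S : Subset n) → Dec (IsESD S)
  isESD? S = all? λ u → (u ∈? ∁ S) →-dec
    (any? (λ v → (v ∈? S) ×-dec ≡-dec Bool._≟_ (N v ∩ ∁ S) ⁅ u ⁆) ×-dec (2 ≤? deg u))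

subsets : ∀ n → List (Subset n)
subsets zero    = [] ∷ []
subsets (suc n) = map (outside ∷_) (subsets n) ++ map (inside ∷_) (subsets n)

-- The default value n of the minimum is harmless: the full vertex set is
-- always an ESD-set (see γesp-attained).
γesp : ∀ {n} → Graph n → ℕ
γesp {n} G = min n (map ∣_∣ (filter (isESD? G) (subsets n)))

Nesp : ∀ {n} → Graph n → ℕ
Nesp {n} G =
  length (filter (λ S → isESD? G S ×-dec (∣ S ∣ ≟ γesp G)) (subsets n))

Path : ∀ n → Graph n
Path n = record
  { Adj    = λ i j → toℕ j ≡ suc (toℕ i) ⊎ toℕ i ≡ suc (toℕ j)
  ; adj?   = λ i j → (toℕ j ≟ suc (toℕ i)) ⊎-dec (toℕ i ≟ suc (toℕ j))
  ; symm   = swap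
  ; irrefl = λ { refl (inj₁ e) → 1+n≢n (sym e) ; refl (inj₂ e) → 1+n≢n (sym e) }
  }

-- Nesp counts every subset exactly once: subsets is complete and repetition-free.

∈-subsets : ∀ {n} (S : Subset n) → S ∈ₗ subsets n
∈-subsets []            = Any.here refl
∈-subsets (outside ∷ S) = ∈-++⁺ˡ (∈-map⁺ (outside ∷_) (∈-subsets S))
∈-subsets {suc n} (inside ∷ S) =
  ∈-++⁺ʳ (map (outside ∷_) (subsets n)) (∈-map⁺ (inside ∷_) (∈-subsets S))

subsets-unique : ∀ n → Unique (subsets n)
subsets-unique zero    = All.[] AllPairs.∷ AllPairs.[]
subsets-unique (suc n) =
  ++⁺ (map⁺ ∷-injectiveʳ (subsets-unique n)) (map⁺ ∷-injectiveʳ (subsets-unique n)) disjoint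
  where
  disjoint : ∀ {S} → ¬ (S ∈ₗ map (outside ∷_) (subsets n) × S ∈ₗ map (inside ∷_) (subsets n))
  disjoint (p , q) with ∈-map⁻ (outside ∷_) p | ∈-map⁻ (inside ∷_) q
  ... | _ , _ , refl | _ , _ , ()

-- γesp is the minimum cardinality of an ESD-set.

⊤-isESD : ∀ {n} (G : Graph n) → IsESD G ⊤
⊤-isESD G u u∈∁⊤ = contradiction ∈⊤ (x∈∁p⇒x∉p u∈∁⊤)

γesp-attained : ∀ {n} (G : Graph n) → ∃ λ S → IsESD G S × ∣ S ∣ ≡ γesp G
γesp-attained {n} G with argmin-sel id n (map ∣_∣ (filter (isESD? G) (subsets n)))
... | inj₁ γ≡n = ⊤ , ⊤-isESD G , trans (∣⊤∣≡n n) (sym γ≡n)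
... | inj₂ γ∈  with ∈-map⁻ ∣_∣ γ∈
...   | S , S∈ , γ≡∣S∣ = S , proj₂ (∈-filter⁻ (isESD? G) {xs = subsets n} S∈) , sym γ≡∣S∣

γesp-minimal : ∀ {n} (G : Graph n) {S} → IsESD G S → γesp G ≤ ∣ S ∣
γesp-minimal {n} G {S} esd =
  min≤v⁺ n (map ∣_∣ (filter (isESD? G) (subsets n)))
    (inj₂ (Any.map (λ e → ≤-reflexive (sym e))
      (∈-map⁺ ∣_∣ (∈-filter⁺ (isESD? G) (∈-subsets S) esd))))

{-# OPTIONS --safe #-}
module Submission where

-- Pad a subset of the path by inside symbols on both sides.  Its first and last
-- symbol must be inside, and then it is an ESD-set iff every outside symbol is
-- immediately preceded or immediately followed by two inside symbols.  A
-- five-state automaton recognises this.  Count +1 for an inside and -1 for an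
-- outside symbol and add the increase of the potential of the state: every
-- transition then costs 0 or 1, and an ESD-set S of total cost d has 2∣S∣ = n + d.
-- The only cost-free cycle is outside outside inside inside, so the words of
-- cost 0, 1, 2 are counted by recurrences of period four in n.

open import Defs
open import Data.Bool using (Bool; true; false; T; T?)
open import Data.Fin using (Fin; zero; suc; toℕ; fromℕ<)
open import Data.Fin.Properties using (toℕ-injective; toℕ<n; toℕ-fromℕ<)
open import Data.Fin.Subset
  using (Subset; Side; inside; outside; _∈_; _∉_; ∁; _∩_; ⁅_⁆; ∣_∣)
open import Data.Fin.Subset.Properties
  using (nonempty?; Empty-unique; ∣⊥∣≡0; ∣⁅x⁆∣≡1; x∈⁅x⁆; x∈⁅y⁆⇒x≡y; p⊆q⇒∣p∣≤∣q∣; ⊆-antisym;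
         x∈∁p⇒x∉p; x∉p⇒x∈∁p; x∈p∩q⁺; x∈p∩q⁻; x∈p⇒∣p-x∣<∣p∣; x∈p∧x≢y⇒x∈p-y)
open import Data.List using ([]; _∷_; _++_; length; map; filter)
open import Data.List.Properties using (filter-++; length-++; filter-≐; filter-none)
open import Data.List.Membership.Propositional using () renaming (_∈_ to _∈ₗ_)
open import Data.List.Membership.Propositional.Properties using (∈-filter⁺; ∈-filter⁻; ∈-length)
open import Data.List.Relation.Unary.All using (universal)
import Data.List.Relation.Unary.Any as Any
open import Data.Nat using (ℕ; zero; suc; _+_; _*_; _^_; _≤_; _<_; _≟_; z≤n; s≤s; s≤s⁻¹; z<s)
open import Data.Nat.Properties
open import Data.Nat.Tactic.RingSolver using (solve-∀)
open import Data.Product using (_×_; _,_; ∃; ∃-syntax; proj₁; proj₂)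
open import Data.Sum using (_⊎_; inj₁; inj₂)
open import Data.Vec using ([]; _∷_; lookup; here)
open import Data.Vec.Properties using ([]=⇒lookup; lookup⇒[]=; lookup∘tabulate)
open import Function using (_∘_; case_of_)
open import Level using (0ℓ)
open import Relation.Binary.PropositionalEquality
open import Relation.Nullary using (yes; no; ¬_; does; contradiction; _×-dec_)
open import Relation.Nullary.Decidable using (dec-true)
open import Relation.Unary using (Pred; Decidable; _≐_)

-- Counting subsets

-- `Nesp` unfolds to an instance of this, so counts of minimum ESD-sets need no separate bridge.
count : ∀ {n} {P : Pred (Subset n) 0ℓ} → Decidable P → ℕ
count {n} P? = length (filter P? (subsets n))

length-filter-map : ∀ {A B : Set} {P : Pred B 0ℓ} (P? : Decidable P) (g : A → B) xs →
  length (filter P? (map g xs)) ≡ length (filter (P? ∘ g) xs)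
length-filter-map P? g []       = refl
length-filter-map P? g (x ∷ xs) with does (P? (g x))
... | true  = cong suc (length-filter-map P? g xs)
... | false = length-filter-map P? g xs

count-suc : ∀ {n} {P : Pred (Subset (suc n)) 0ℓ} (P? : Decidable P) →
  count P? ≡ count (P? ∘ (outside ∷_)) + count (P? ∘ (inside ∷_))
count-suc {n} P? = begin
  count P?
    ≡⟨ cong length (filter-++ P? (map (outside ∷_) (subsets n)) _) ⟩
  length (filter P? (map (outside ∷_) (subsets n)) ++ filter P? (map (inside ∷_) (subsets n)))
    ≡⟨ length-++ (filter P? (map (outside ∷_) (subsets n))) ⟩
  length (filter P? (map (outside ∷_) (subsets n))) + length (filter P? (map (inside ∷_) (subsets n)))
    ≡⟨ cong₂ _+_ (length-filter-map P? _ (subsets n)) (length-filter-map P? _ (subsets n)) ⟩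
  count (P? ∘ (outside ∷_)) + count (P? ∘ (inside ∷_)) ∎
  where open ≡-Reasoning

count-≐ : ∀ {n} {P Q : Pred (Subset n) 0ℓ} (P? : Decidable P) (Q? : Decidable Q) →
  P ≐ Q → count P? ≡ count Q?
count-≐ {n} P? Q? P≐Q = cong length (filter-≐ P? Q? P≐Q (subsets n))

count-none : ∀ {n} {P : Pred (Subset n) 0ℓ} (P? : Decidable P) → (∀ S → ¬ P S) → count P? ≡ 0
count-none {n} P? ¬P = cong length (filter-none P? (universal ¬P (subsets n)))

∃⇒count>0 : ∀ {n} {P : Pred (Subset n) 0ℓ} (P? : Decidable P) {S} → P S → 0 < count P?
∃⇒count>0 P? {S} PS = ∈-length (∈-filter⁺ P? (∈-subsets S) PS)

count>0⇒∃ : ∀ {n} {P : Pred (Subset n) 0ℓ} (P? : Decidable P) → 0 < count P? → ∃ P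
count>0⇒∃ {n} P? 0<c with filter P? (subsets n) in eq
... | S ∷ _ = S , proj₂ (∈-filter⁻ P? {xs = subsets n} (subst (S ∈ₗ_) (sym eq) (Any.here refl)))

-- The automaton

-- The state records the padded word read so far.  A: it ends in inside inside.
-- B: in an outside vertex preceded by two inside ones.  C: in such a vertex and
-- an inside one.  D: in an outside vertex that still needs two inside
-- successors.  E: in such a vertex and the first of these successors.
data State : Set where
  A B C D E : State

potential : State → ℕ
potential A = 0
potential B = 1
potential C = 1
potential D = 2
potential E = 1

-- The number is the exact cost still to be spent, not an upper bound. At the end of the word the
-- right padding acts as one more inside symbol leading to `A`: this costs 1 from `A` and 0 from `C`
-- and `E`. `B` and `D` reject there, since an end vertex of the path cannot be outside.
accept : State → ∀ {n} → Subset n → ℕ → Bool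
accept A []            1       = true
accept A []            _       = false
accept B []            _       = false
accept C []            0       = true
accept C []            _       = false
accept D []            _       = false
accept E []            0       = true
accept E []            _       = false
accept A (outside ∷ w) d       = accept B w d
accept A (inside ∷ w)  zero    = false
accept A (inside ∷ w)  (suc d) = accept A w d
accept B (outside ∷ w) d       = accept D w d
accept B (inside ∷ w)  zero    = false
accept B (inside ∷ w)  (suc d) = accept C w d
accept C (outside ∷ w) d       = accept D w d
accept C (inside ∷ w)  d       = accept A w d
accept D (outside ∷ w) d       = false
accept D (inside ∷ w)  d       = accept E w d
accept E (outside ∷ w) d       = false
accept E (inside ∷ w)  d       = accept A w d

words : State → ℕ → ℕ → ℕ
words A zero    1       = 1
words A zero    _       = 0
words B zero    _       = 0
words C zero    0       = 1
words C zero    _       = 0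
words D zero    _       = 0
words E zero    0       = 1
words E zero    _       = 0
words A (suc n) zero    = words B n zero
words A (suc n) (suc d) = words B n (suc d) + words A n d
words B (suc n) zero    = words D n zero
words B (suc n) (suc d) = words D n (suc d) + words C n d
words C (suc n) d       = words D n d + words A n d
words D (suc n) d       = words E n d
words E (suc n) d       = words A n d

accept? : ∀ s n d → Decidable (λ (w : Subset n) → T (accept s w d))
accept? s n d w = T? (accept s w d)

count-accept : ∀ s n d → count (accept? s n d) ≡ words s n d
count-accept A zero    0             = refl
count-accept A zero    1             = refl
count-accept A zero    (suc (suc d)) = refl
count-accept B zero    d             = refl
count-accept C zero    zero          = refl
count-accept C zero    (suc d)       = refl
count-accept D zero    d             = refl
count-accept E zero    zero          = refl
count-accept E zero    (suc d)       = refl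
count-accept A (suc n) zero          = trans (count-suc (accept? A (suc n) zero))
  (trans (cong₂ _+_ (count-accept B n zero) (count-none {n} (λ _ → T? false) λ _ ())) (+-identityʳ _))
count-accept A (suc n) (suc d)       = trans (count-suc (accept? A (suc n) (suc d)))
  (cong₂ _+_ (count-accept B n (suc d)) (count-accept A n d))
count-accept B (suc n) zero          = trans (count-suc (accept? B (suc n) zero))
  (trans (cong₂ _+_ (count-accept D n zero) (count-none {n} (λ _ → T? false) λ _ ())) (+-identityʳ _))
count-accept B (suc n) (suc d)       = trans (count-suc (accept? B (suc n) (suc d)))
  (cong₂ _+_ (count-accept D n (suc d)) (count-accept C n d))
count-accept C (suc n) d             = trans (count-suc (accept? C (suc n) d))
  (cong₂ _+_ (count-accept D n d) (count-accept A n d))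
count-accept D (suc n) d             = trans (count-suc (accept? D (suc n) d))
  (cong₂ _+_ (count-none {n} (λ _ → T? false) λ _ ()) (count-accept E n d))
count-accept E (suc n) d             = trans (count-suc (accept? E (suc n) d))
  (cong₂ _+_ (count-none {n} (λ _ → T? false) λ _ ()) (count-accept A n d))

-- Cost and cardinality

private
  cost-outside : ∀ {c} n d p → c ≡ n + d + suc p → c ≡ suc n + d + p
  cost-outside n d p e = trans e (+-suc (n + d) p)

  cost-inside : ∀ {x y} c → suc (2 * c) ≡ x → 2 + x ≡ y → suc (2 * suc c) ≡ y
  cost-inside c e e′ = trans (cong suc (*-suc 2 c)) (trans (cong (2 +_) e) e′)

  loss : ∀ n d p → 2 + (n + d + p) ≡ suc n + suc d + p
  loss = solve-∀

  free : ∀ n d p → 2 + (n + d + p) ≡ suc n + d + suc p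
  free = solve-∀

-- The potential telescopes from `potential s` down to 0, its value in `A` after the closing padding
-- symbol. That symbol also contributes the leading `suc`.
accept-cost : ∀ s {n} (w : Subset n) d → T (accept s w d) →
  suc (2 * ∣ w ∣) ≡ n + d + potential s
accept-cost A []            1       t = refl
accept-cost C []            0       t = refl
accept-cost E []            0       t = refl
accept-cost A (outside ∷ w) d       t = cost-outside _ d 0 (accept-cost B w d t)
accept-cost A (inside ∷ w)  (suc d) t = cost-inside ∣ w ∣ (accept-cost A w d t) (loss _ d 0)
accept-cost B (outside ∷ w) d       t = cost-outside _ d 1 (accept-cost D w d t)
accept-cost B (inside ∷ w)  (suc d) t = cost-inside ∣ w ∣ (accept-cost C w d t) (loss _ d 1)
accept-cost C (outside ∷ w) d       t = cost-outside _ d 1 (accept-cost D w d t)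
accept-cost C (inside ∷ w)  d       t = cost-inside ∣ w ∣ (accept-cost A w d t) (free _ d 0)
accept-cost D (inside ∷ w)  d       t = cost-inside ∣ w ∣ (accept-cost E w d t) (free _ d 1)
accept-cost E (inside ∷ w)  d       t = cost-inside ∣ w ∣ (accept-cost A w d t) (free _ d 0)

-- Correctness of the automaton

-- Beyond the last vertex every symbol reads as inside: this is the padding on the right.
at : ∀ {n} → Subset n → ℕ → Side
at []      i       = inside
at (x ∷ w) zero    = x
at (x ∷ w) (suc i) = at w i

-- a and b are the two symbols to the left of w.
Flanked : Side → Side → ∀ {n} → Subset n → Set
Flanked a b {n} w = ∀ i → at w i ≡ outside → suc i < n ×
  ((at (a ∷ b ∷ w) i ≡ inside × at (b ∷ w) i ≡ inside)
    ⊎ (at w (1 + i) ≡ inside × at w (2 + i) ≡ inside))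

Flanked-tail : ∀ {a b x n} {w : Subset n} → Flanked a b (x ∷ w) → Flanked b x w
Flanked-tail fl i e with fl (suc i) e
... | s≤s i<n , f = i<n , f

Flanked-inside : ∀ {a b n} {w : Subset n} → Flanked b inside w → Flanked a b (inside ∷ w)
Flanked-inside fl (suc i) e with fl i e
... | i<n , f = s≤s i<n , f

Flanked-outside : ∀ {a b n} {w : Subset n} → 0 < n →
  (a ≡ inside × b ≡ inside) ⊎ (at w 0 ≡ inside × at w 1 ≡ inside) →
  Flanked b outside w → Flanked a b (outside ∷ w)
Flanked-outside 0<n f fl zero    e = s≤s 0<n , f
Flanked-outside 0<n f fl (suc i) e with fl i e
... | i<n , g = s≤s i<n , g

-- An outside symbol makes the symbol two places to its left irrelevant to its successor.
Flanked-after-outside : ∀ {a a′ n} {w : Subset n} → Flanked a outside w → Flanked a′ outside w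
Flanked-after-outside fl zero e with fl zero e
... | i<n , inj₁ (_ , ())
... | i<n , inj₂ f = i<n , inj₂ f
Flanked-after-outside fl (suc i) e = fl (suc i) e

-- Besides the left context, each state keeps the debts of the last outside symbol. In `B` and `D`
-- the conjunct `0 < n` is the bound `suc i < n` still owed to the symbol just read; `D` owes two
-- inside symbols and `E` one.
Invariant : State → ∀ {n} → Subset n → Set
Invariant A     w = Flanked inside inside w
Invariant B {n} w = 0 < n × Flanked inside outside w
Invariant C     w = Flanked outside inside w
Invariant D {n} w = 0 < n × (at w 0 ≡ inside × at w 1 ≡ inside) × Flanked outside outside w
Invariant E     w = at w 0 ≡ inside × Flanked outside inside w

accept⇒Invariant : ∀ s {n} (w : Subset n) d → T (accept s w d) → Invariant s w
accept⇒Invariant A []            d       t = λ _ ()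
accept⇒Invariant C []            d       t = λ _ ()
accept⇒Invariant E []            d       t = refl , λ _ ()
accept⇒Invariant A (outside ∷ w) d       t with accept⇒Invariant B w d t
... | 0<n , fl = Flanked-outside 0<n (inj₁ (refl , refl)) fl
accept⇒Invariant A (inside ∷ w)  (suc d) t = Flanked-inside (accept⇒Invariant A w d t)
accept⇒Invariant B (outside ∷ w) d       t with accept⇒Invariant D w d t
... | 0<n , f , fl = z<s , Flanked-outside 0<n (inj₂ f) fl
accept⇒Invariant B (inside ∷ w)  (suc d) t = z<s , Flanked-inside (accept⇒Invariant C w d t)
accept⇒Invariant C (outside ∷ w) d       t with accept⇒Invariant D w d t
-- Coming from `C`, the true left context is inside outside, whereas the invariant of `D` records
-- outside outside.
... | 0<n , f , fl = Flanked-outside 0<n (inj₂ f) (Flanked-after-outside fl)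
accept⇒Invariant C (inside ∷ w)  d       t = Flanked-inside (accept⇒Invariant A w d t)
accept⇒Invariant D (inside ∷ w)  d       t with accept⇒Invariant E w d t
... | e , fl = z<s , (refl , e) , Flanked-inside fl
accept⇒Invariant E (inside ∷ w)  d       t = refl , Flanked-inside (accept⇒Invariant A w d t)

Invariant⇒accept : ∀ s {n} (w : Subset n) → Invariant s w → ∃[ d ] T (accept s w d)
Invariant⇒accept A []            fl = 1 , _
Invariant⇒accept C []            fl = 0 , _
Invariant⇒accept E []            fl = 0 , _
Invariant⇒accept A (outside ∷ w) fl = Invariant⇒accept B w
  (s≤s⁻¹ (proj₁ (fl zero refl)) , Flanked-tail fl)
Invariant⇒accept A (inside ∷ w)  fl with Invariant⇒accept A w (Flanked-tail fl)
... | d , t = suc d , t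
Invariant⇒accept B (outside ∷ w) (_ , fl) with fl zero refl
-- The previous symbol is outside, so only the flank on the right remains.
... | 1<n , inj₁ (_ , ())
... | 1<n , inj₂ f = Invariant⇒accept D w (s≤s⁻¹ 1<n , f , Flanked-tail fl)
Invariant⇒accept B (inside ∷ w)  (_ , fl) with Invariant⇒accept C w (Flanked-tail fl)
... | d , t = suc d , t
Invariant⇒accept C (outside ∷ w) fl with fl zero refl
... | 1<n , inj₁ (() , _)
... | 1<n , inj₂ f =
  Invariant⇒accept D w (s≤s⁻¹ 1<n , f , Flanked-after-outside (Flanked-tail fl))
Invariant⇒accept C (inside ∷ w)  fl = Invariant⇒accept A w (Flanked-tail fl)
Invariant⇒accept D (inside ∷ w)  (_ , (_ , e) , fl) = Invariant⇒accept E w (e , Flanked-tail fl)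
Invariant⇒accept E (inside ∷ w)  (_ , fl) = Invariant⇒accept A w (Flanked-tail fl)

-- Neighbourhoods

module _ {n : ℕ} (G : Graph n) where
  open Graph G

  ∈N⁺ : ∀ {v w} → Adj v w → w ∈ N G v
  ∈N⁺ {v} {w} vw = lookup⇒[]= w _ (trans (lookup∘tabulate _ w) (dec-true (adj? v w) vw))

  ∈N⁻ : ∀ {v w} → w ∈ N G v → Adj v w
  ∈N⁻ {v} {w} w∈
    with adj? v w | trans (sym (lookup∘tabulate (λ x → does (adj? v x)) w)) ([]=⇒lookup w∈)
  ... | yes vw | _  = vw
  ... | no  _  | ()

  module _ {S : Subset n} {u v : Fin n} where

    private-neighbour⁺ : Adj v u → u ∉ S → (∀ {w} → Adj v w → w ∉ S → w ≡ u) →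
      N G v ∩ ∁ S ≡ ⁅ u ⁆
    private-neighbour⁺ vu u∉S only = ⊆-antisym to from
      where
      to : ∀ {w} → w ∈ N G v ∩ ∁ S → w ∈ ⁅ u ⁆
      to w∈ with x∈p∩q⁻ _ _ w∈
      ... | w∈N , w∈∁ with only (∈N⁻ w∈N) (x∈∁p⇒x∉p w∈∁)
      ... | refl = x∈⁅x⁆ u
      from : ∀ {w} → w ∈ ⁅ u ⁆ → w ∈ N G v ∩ ∁ S
      from w∈ with x∈⁅y⁆⇒x≡y u w∈
      ... | refl = x∈p∩q⁺ (∈N⁺ vu , x∉p⇒x∈∁p u∉S)

    private-neighbour-adj : N G v ∩ ∁ S ≡ ⁅ u ⁆ → Adj v u
    private-neighbour-adj eq =
      ∈N⁻ (proj₁ (x∈p∩q⁻ (N G v) (∁ S) (subst (u ∈_) (sym eq) (x∈⁅x⁆ u))))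

    private-neighbour-only : N G v ∩ ∁ S ≡ ⁅ u ⁆ → ∀ {w} → Adj v w → w ∉ S → w ≡ u
    private-neighbour-only eq vw w∉S =
      x∈⁅y⁆⇒x≡y u (subst (_ ∈_) eq (x∈p∩q⁺ (∈N⁺ vw , x∉p⇒x∈∁p w∉S)))

-- Small cardinalities and positions in a subset

∣p∣≤1 : ∀ {n} (p : Subset n) → (∀ {x y} → x ∈ p → y ∈ p → x ≡ y) → ∣ p ∣ ≤ 1
∣p∣≤1 {n} p unique with nonempty? p
... | yes (x , x∈p) = ≤-trans (p⊆q⇒∣p∣≤∣q∣ p⊆⁅x⁆) (≤-reflexive (∣⁅x⁆∣≡1 x))
  where
  p⊆⁅x⁆ : ∀ {y} → y ∈ p → y ∈ ⁅ x ⁆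
  p⊆⁅x⁆ y∈p with unique x∈p y∈p
  ... | refl = x∈⁅x⁆ x
... | no empty = ≤-trans (≤-reflexive (trans (cong ∣_∣ (Empty-unique empty)) (∣⊥∣≡0 n))) z≤n

2≤∣p∣ : ∀ {n} {p : Subset n} {x y} → x ∈ p → y ∈ p → x ≢ y → 2 ≤ ∣ p ∣
2≤∣p∣ x∈p y∈p x≢y =
  ≤-trans (s≤s (≤-trans (s≤s z≤n) (x∈p⇒∣p-x∣<∣p∣ (x∈p∧x≢y⇒x∈p-y x∈p x≢y)))) (x∈p⇒∣p-x∣<∣p∣ y∈p)

at-toℕ : ∀ {n} (S : Subset n) x → at S (toℕ x) ≡ lookup S x
at-toℕ (s ∷ S) zero    = refl
at-toℕ (s ∷ S) (suc x) = at-toℕ S x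

∈⇒at : ∀ {n} {S : Subset n} {x} → x ∈ S → at S (toℕ x) ≡ inside
∈⇒at {S = S} {x} x∈S = trans (at-toℕ S x) ([]=⇒lookup x∈S)

at⇒∈ : ∀ {n} {S : Subset n} {x} → at S (toℕ x) ≡ inside → x ∈ S
at⇒∈ {S = S} {x} e = lookup⇒[]= x S (trans (sym (at-toℕ S x)) e)

at-outside⇒∉ : ∀ {n} (S : Subset n) x → at S (toℕ x) ≡ outside → x ∉ S
at-outside⇒∉ S x e x∈S with () ← trans (sym e) (∈⇒at x∈S)

∉⇒at-outside : ∀ {n} {S : Subset n} {x} → x ∉ S → at S (toℕ x) ≡ outside
∉⇒at-outside {S = S} {x} x∉S with at S (toℕ x) in eq
... | inside  = contradiction (at⇒∈ eq) x∉S
... | outside = refl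

at-outside⇒vertex : ∀ {n} (S : Subset n) i → at S i ≡ outside → ∃[ x ] toℕ {n} x ≡ i
at-outside⇒vertex (s ∷ S) zero    e = zero , refl
at-outside⇒vertex (s ∷ S) (suc i) e with at-outside⇒vertex S i e
... | x , eq = suc x , cong suc eq

-- Phrased by positions so as to cover the padding as well: past the last vertex the hypothesis is
-- vacuous.
at-inside : ∀ {n} (S : Subset n) i → (∀ x → toℕ {n} x ≡ i → ¬ x ∉ S) → at S i ≡ inside
at-inside S i h with at S i in eq
... | inside  = refl
... | outside with at-outside⇒vertex S i eq
...   | x , refl = contradiction (at-outside⇒∉ S x eq) (h x refl)

-- ESD-sets of a path

module _ {m : ℕ} where
  open Graph (Path (suc m)) using (Adj)

  private
    P = Path (suc m)

  deg-first : deg P zero ≤ 1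
  deg-first = ∣p∣≤1 _ λ x∈ y∈ → toℕ-injective (trans (second (∈N⁻ P x∈)) (sym (second (∈N⁻ P y∈))))
    where
    second : ∀ {x} → Adj zero x → toℕ x ≡ 1
    second (inj₁ e) = e

  -- Position `toℕ j` of `w` is the vertex `suc j` of the path. With `deg-interior`, this turns the
  -- degree condition on outside vertices into the bound `suc i < n` of `Flanked`.
  deg-last : ∀ (j : Fin m) → m ≤ suc (toℕ j) → deg P (suc j) ≤ 1
  deg-last j m≤ =
    ∣p∣≤1 _ λ x∈ y∈ → toℕ-injective (trans (sym (previous (∈N⁻ P x∈))) (previous (∈N⁻ P y∈)))
    where
    previous : ∀ {x} → Adj (suc j) x → toℕ j ≡ toℕ x
    previous {x} (inj₁ e) =
      contradiction (≤-trans (≤-reflexive (sym e)) (s≤s⁻¹ (toℕ<n x))) (≤⇒≯ m≤)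
    previous (inj₂ e) = suc-injective e

  deg-interior : ∀ (j : Fin m) → suc (toℕ j) < m → 2 ≤ deg P (suc j)
  deg-interior j j<m = 2≤∣p∣ {x = x} {y} (∈N⁺ P (inj₂ (cong suc (sym x≡)))) (∈N⁺ P (inj₁ y≡)) x≢y
    where
    j<1+m = ≤-trans (toℕ<n j) (n≤1+n m)
    x = fromℕ< {toℕ j} {suc m} j<1+m
    y = fromℕ< {2 + toℕ j} (s≤s j<m)
    x≡ : toℕ x ≡ toℕ j
    x≡ = toℕ-fromℕ< j<1+m
    y≡ : toℕ y ≡ 2 + toℕ j
    y≡ = toℕ-fromℕ< (s≤s j<m)
    x≢y : x ≢ y
    x≢y e = m≢1+n+m (toℕ j) {1} (trans (sym x≡) (trans (cong toℕ e) y≡))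

  -- The vertex `v` that has u as its only outside neighbour lies directly before or after u. It is
  -- inside, and so is its other neighbour, if there is one; otherwise the padding supplies that
  -- symbol.
  ESD⇒Flanked : ∀ {w : Subset m} → IsESD P (inside ∷ w) → Flanked inside inside w
  ESD⇒Flanked {w} esd i e with at-outside⇒vertex w i e
  ... | j , refl with esd (suc j) (x∉p⇒x∈∁p (at-outside⇒∉ (inside ∷ w) (suc j) e))
  ... | (v , v∈S , eq) , 2≤deg = ≰⇒> (λ m≤ → ≤⇒≯ (deg-last j m≤) 2≤deg) ,
    flank (private-neighbour-adj P eq)
    where
    S = inside ∷ w
    others : ∀ {k} → k ≢ suc (toℕ j) → (∀ x → toℕ x ≡ k → Adj v x) → at S k ≡ inside
    others {k} k≢ adj = at-inside S k λ x x≡k x∉S →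
      k≢ (trans (sym x≡k) (cong toℕ (private-neighbour-only P eq (adj x x≡k) x∉S)))
    flank : Adj v (suc j) → (at (inside ∷ S) (toℕ j) ≡ inside × at S (toℕ j) ≡ inside)
      ⊎ (at w (1 + toℕ j) ≡ inside × at w (2 + toℕ j) ≡ inside)
    flank (inj₁ u≡) = inj₁ (before (toℕ j) refl , subst (λ k → at S k ≡ inside) (sym j≡) (∈⇒at v∈S))
      where
      j≡ : toℕ j ≡ toℕ v
      j≡ = suc-injective u≡
      before : ∀ k → k ≡ toℕ j → at (inside ∷ S) k ≡ inside
      -- Here `v` is the first vertex, and the symbol before it is the left padding.
      before zero    _ = refl
      before (suc k) k≡ = others
        (λ k≡1+j → m≢1+n+m k {1} (trans k≡1+j (cong suc (sym k≡))))
        (λ x x≡k → inj₂ (trans (sym j≡) (trans (sym k≡) (cong suc (sym x≡k)))))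
    flank (inj₂ v≡) = inj₂
      ( subst (λ k → at S k ≡ inside) v≡ (∈⇒at v∈S)
      -- This position may lie past the last vertex, where the adjacency requirement is vacuous.
      , others {3 + toℕ j} (λ e → m≢1+n+m (suc (toℕ j)) {1} (sym e))
          (λ x x≡k → inj₁ (trans x≡k (cong suc (sym v≡)))))

  -- Of the two flanking inside symbols, the one next to u is the required vertex `v`; the other one
  -- ensures that `v` has no second outside neighbour.
  Flanked⇒ESD : ∀ {w : Subset m} → Flanked inside inside w → IsESD P (inside ∷ w)
  Flanked⇒ESD {w} fl zero u∈ = contradiction here (x∈∁p⇒x∉p u∈)
  Flanked⇒ESD {w} fl (suc j) u∈ with fl (toℕ j) (∉⇒at-outside {S = inside ∷ w} (x∈∁p⇒x∉p u∈))
  ... | j<m , flank = neighbour flank , deg-interior j j<m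
    where
    S = inside ∷ w
    u∉S = x∈∁p⇒x∉p u∈
    neighbour : (at (inside ∷ S) (toℕ j) ≡ inside × at S (toℕ j) ≡ inside)
      ⊎ (at w (1 + toℕ j) ≡ inside × at w (2 + toℕ j) ≡ inside) →
      ∃[ v ] v ∈ S × N P v ∩ ∁ S ≡ ⁅ suc j ⁆
    neighbour (inj₁ (e₂ , e₁)) = v , at⇒∈ (subst (λ k → at S k ≡ inside) (sym v≡) e₁) ,
      private-neighbour⁺ P (inj₁ (cong suc (sym v≡))) u∉S only
      where
      j<1+m = ≤-trans (toℕ<n j) (n≤1+n m)
      v = fromℕ< {toℕ j} {suc m} j<1+m
      v≡ : toℕ v ≡ toℕ j
      v≡ = toℕ-fromℕ< j<1+m
      only : ∀ {x} → Adj v x → x ∉ S → x ≡ suc j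
      only (inj₁ x≡) x∉S = toℕ-injective (trans x≡ (cong suc v≡))
      only (inj₂ v≡1+x) x∉S = contradiction
        (at⇒∈ (subst (λ k → at (inside ∷ S) k ≡ inside) (trans (sym v≡) v≡1+x) e₂)) x∉S
    neighbour (inj₂ (e₁ , e₂)) = v , at⇒∈ (subst (λ k → at S k ≡ inside) (sym v≡) e₁) ,
      private-neighbour⁺ P (inj₂ v≡) u∉S only
      where
      -- The bound `j<m` says that `suc j` is not the last vertex, so its right neighbour exists.
      v = fromℕ< {2 + toℕ j} (s≤s j<m)
      v≡ : toℕ v ≡ 2 + toℕ j
      v≡ = toℕ-fromℕ< (s≤s j<m)
      only : ∀ {x} → Adj v x → x ∉ S → x ≡ suc j
      only (inj₁ x≡) x∉S = contradiction
        (at⇒∈ (subst (λ k → at S k ≡ inside) (sym (trans x≡ (cong suc v≡))) e₂)) x∉S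
      only (inj₂ v≡1+x) x∉S = toℕ-injective (suc-injective (trans (sym v≡1+x) v≡))

  -- The first vertex has degree at most 1 and hence is inside. Together with the left padding it
  -- puts the automaton in state `A` before `w` is read.
  ESD⇒accept : ∀ {x} {w : Subset m} → IsESD P (x ∷ w) → x ≡ inside × ∃[ d ] T (accept A w d)
  ESD⇒accept {inside}  {w} esd = refl , Invariant⇒accept A w (ESD⇒Flanked esd)
  ESD⇒accept {outside} {w} esd =
    contradiction (proj₂ (esd zero (x∉p⇒x∈∁p λ ()))) (≤⇒≯ deg-first)

  accept⇒ESD : ∀ (w : Subset m) d → T (accept A w d) → IsESD P (inside ∷ w)
  accept⇒ESD w d t = Flanked⇒ESD (accept⇒Invariant A w d t)

-- Minimum cardinality as minimum cost

accept-size : ∀ {m} (w : Subset m) d → T (accept A w d) → 2 * ∣ inside ∷ w ∣ ≡ suc m + d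
accept-size {m} w d t = trans (*-suc 2 ∣ w ∣)
  (cong suc (trans (accept-cost A w d t) (+-identityʳ (m + d))))

-- The predicate Q and its minimum γ are variables here, since unfolding IsESD and
-- γesp for a path makes type checking very slow.
module MinimumSize {m : ℕ} {Q : Pred (Subset (suc m)) 0ℓ}
  (Q⇒accept : ∀ {x w} → Q (x ∷ w) → x ≡ inside × ∃[ d ] T (accept A w d))
  (accept⇒Q : ∀ w d → T (accept A w d) → Q (inside ∷ w))
  {γ : ℕ} (attained : ∃ λ S → Q S × ∣ S ∣ ≡ γ) (minimal : ∀ {S} → Q S → γ ≤ ∣ S ∣)
  {δ : ℕ} (none : ∀ {d} → d < δ → words A m d ≡ 0) (some : 0 < words A m δ) where

  -- By `accept-size` cardinality grows with cost. No accepted word costs less than `δ`, and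
  -- comparison with an accepted word of cost `δ` bounds `d` from above.
  least-cost : ∀ w {d} → T (accept A w d) → ∣ inside ∷ w ∣ ≡ γ → d ≡ δ
  least-cost w {d} t ∣S∣≡γ = ≤-antisym d≤δ δ≤d
    where
    δ≤d : δ ≤ d
    δ≤d = ≮⇒≥ λ d<δ → n≮0
      (subst (0 <_) (trans (count-accept A m d) (none d<δ)) (∃⇒count>0 (accept? A m d) {w} t))
    d≤δ : d ≤ δ
    d≤δ with count>0⇒∃ (accept? A m δ) (subst (0 <_) (sym (count-accept A m δ)) some)
    ... | w′ , t′ = +-cancelˡ-≤ (suc m) d δ (begin
      suc m + d            ≡⟨ accept-size w d t ⟨
      2 * ∣ inside ∷ w ∣   ≡⟨ cong (2 *_) ∣S∣≡γ ⟩
      2 * γ                ≤⟨ *-monoʳ-≤ 2 (minimal (accept⇒Q w′ δ t′)) ⟩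
      2 * ∣ inside ∷ w′ ∣  ≡⟨ accept-size w′ δ t′ ⟩
      suc m + δ            ∎)
      where open ≤-Reasoning

  2γ≡ : 2 * γ ≡ suc m + δ
  2γ≡ = size attained
    where
    size : (∃ λ S → Q S × ∣ S ∣ ≡ γ) → 2 * γ ≡ suc m + δ
    size (x ∷ w , q , ∣S∣≡γ) with Q⇒accept q
    ... | refl , d , t = trans (cong (2 *_) (sym ∣S∣≡γ))
      (trans (accept-size w d t) (cong (suc m +_) (least-cost w t ∣S∣≡γ)))

  count-minimum : (Q? : Decidable Q) → count (λ S → Q? S ×-dec (∣ S ∣ ≟ γ)) ≡ words A m δ
  count-minimum Q? = begin
    count minimum?
      ≡⟨ count-suc minimum? ⟩
    count (minimum? ∘ (outside ∷_)) + count (minimum? ∘ (inside ∷_))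
      ≡⟨ cong₂ _+_ (count-none (minimum? ∘ (outside ∷_)) λ w (q , _) → case proj₁ (Q⇒accept q) of λ ())
                   (count-≐ (minimum? ∘ (inside ∷_)) (accept? A m δ) (to , from)) ⟩
    count (accept? A m δ)
      ≡⟨ count-accept A m δ ⟩
    words A m δ ∎
    where
    open ≡-Reasoning
    minimum? : Decidable (λ S → Q S × ∣ S ∣ ≡ γ)
    minimum? S = Q? S ×-dec (∣ S ∣ ≟ γ)
    to : ∀ {w} → Q (inside ∷ w) × ∣ inside ∷ w ∣ ≡ γ → T (accept A w δ)
    to {w} (q , ∣S∣≡γ) = let _ , d , t = Q⇒accept q in
      subst (T ∘ accept A w) (least-cost w t ∣S∣≡γ) t
    from : ∀ {w} → T (accept A w δ) → Q (inside ∷ w) × ∣ inside ∷ w ∣ ≡ γ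
    from {w} t = accept⇒Q w δ t , *-cancelˡ-≡ _ _ 2 (trans (accept-size w δ t) (sym 2γ≡))

-- Stated for n ≡ suc m because comparing two spellings of a successor inside Nesp
-- makes Agda unfold the enumeration of subsets.
Nesp-Path : ∀ {n m δ} → n ≡ suc m → (∀ {d} → d < δ → words A m d ≡ 0) → 0 < words A m δ →
  Nesp (Path n) ≡ words A m δ
Nesp-Path {m = m} refl none some =
  MinimumSize.count-minimum ESD⇒accept accept⇒ESD
    (γesp-attained (Path (suc m))) (γesp-minimal (Path (suc m))) none some (isESD? (Path (suc m)))

-- Words of cost at most two

-- Four transitions from A unfold definitionally to
--   words A (4 + n) (1 + d) = words A n (1 + d) + (words E n d + words A (1 + n) d) + words A (3 + n) d,
-- and for d = 0 to words A (4 + n) 0 = words A n 0.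
words-A0 : ∀ k →
  words A (k * 4) 0 ≡ 0 × words A (1 + k * 4) 0 ≡ 0 ×
  words A (2 + k * 4) 0 ≡ 0 × words A (3 + k * 4) 0 ≡ 1
words-A0 zero    = refl , refl , refl , refl
words-A0 (suc k) = words-A0 k

-- `E` must read an inside symbol and passes to `A` for free, which shifts the values of `words-A0`
-- by one length.
words-E0 : ∀ k → words E (k * 4) 0 ≡ 1 × words E (1 + k * 4) 0 ≡ 0 × words E (2 + k * 4) 0 ≡ 0
words-E0 zero    = refl , refl , refl
words-E0 (suc k) with words-A0 k | words-A0 (suc k)
... | _ , _ , _ , a₃ | a₄ , a₅ , _ = a₃ , a₄ , a₅

-- By the four-step recurrence with `d` = 0, the cost-free counts add 2, 0 and 1 per period in the
-- three residue classes.
words-A1 : ∀ k →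
  words A (k * 4) 1 ≡ 2 * k + 1 × words A (1 + k * 4) 1 ≡ 0 × words A (2 + k * 4) 1 ≡ k + 1
words-A1 zero    = refl , refl , refl
words-A1 (suc k) with words-A0 k | words-A0 (suc k) | words-E0 k | words-A1 k
... | a₀ , a₁ , a₂ , a₃ | a₄ , a₅ , _ | e₀ , e₁ , e₂ | b₀ , b₁ , b₂
  = trans (cong₂ _+_ (cong₂ _+_ b₀ (cong₂ _+_ e₀ a₁)) a₃) (cost0 k)
  , cong₂ _+_ (cong₂ _+_ b₁ (cong₂ _+_ e₁ a₂)) a₄
  , trans (cong₂ _+_ (cong₂ _+_ b₂ (cong₂ _+_ e₂ a₃)) a₅) (cost2 k)
  where
  cost0 : ∀ k → 2 * k + 1 + (1 + 0) + 1 ≡ 2 * suc k + 1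
  cost0 = solve-∀
  cost2 : ∀ k → k + 1 + (0 + 1) + 0 ≡ suc k + 1
  cost2 = solve-∀

-- In the recurrence with `d` = 1, `words E (1 + k * 4) 1` unfolds to `words A (k * 4) 1`. The
-- increment is therefore (2k + 1) + (k + 1) + (2k + 3) = 5(k + 1), whose partial sums give the
-- quadratic.
words-A2 : ∀ k → 2 * words A (1 + k * 4) 2 ≡ 5 * k ^ 2 + 5 * k + 2
words-A2 zero    = refl
words-A2 (suc k) with words-A1 k | words-A1 (suc k)
... | b₀ , _ , b₂ | b₄ , _ = begin
  2 * words A (5 + k * 4) 2
    ≡⟨ cong (2 *_) (cong₂ _+_ (cong (words A (1 + k * 4) 2 +_) (cong₂ _+_ b₀ b₂)) b₄) ⟩
  2 * (words A (1 + k * 4) 2 + (2 * k + 1 + (k + 1)) + (2 * suc k + 1))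
    ≡⟨ expand (words A (1 + k * 4) 2) k ⟩
  2 * words A (1 + k * 4) 2 + 10 * suc k
    ≡⟨ cong (_+ 10 * suc k) (words-A2 k) ⟩
  5 * k ^ 2 + 5 * k + 2 + 10 * suc k
    ≡⟨ collect k ⟩
  5 * suc k ^ 2 + 5 * suc k + 2 ∎
  where
  open ≡-Reasoning
  expand : ∀ c k → 2 * (c + (2 * k + 1 + (k + 1)) + (2 * suc k + 1)) ≡ 2 * c + 10 * suc k
  expand = solve-∀
  -- The squares are unfolded because the ring solver rejects the exponent.
  collect : ∀ k → 5 * (k * (k * 1)) + 5 * k + 2 + 10 * suc k ≡ 5 * (suc k * (suc k * 1)) + 5 * suc k + 2
  collect = solve-∀

-- The four residue classes

theorem8p3 : (n k : ℕ) → 2 ≤ n →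
    (n ≡ 4 * k → Nesp (Path n) ≡ 1)
    × (n ≡ 4 * k + 1 → Nesp (Path n) ≡ 2 * k + 1)
    -- the exact fraction (5k² + 5k + 2) / 2, cleared of its denominator
    × (n ≡ 4 * k + 2 → 2 * Nesp (Path n) ≡ 5 * k ^ 2 + 5 * k + 2)
    × (n ≡ 4 * k + 3 → Nesp (Path n) ≡ k + 1)
theorem8p3 n k 2≤n = case₀ k , case₁ , case₂ , case₃
  where
  reorder : ∀ r → n ≡ 4 * k + r → n ≡ r + k * 4
  reorder r e = trans e (trans (+-comm (4 * k) r) (cong (r +_) (*-comm 4 k)))
  -- The automaton reads the n - 1 symbols after the first vertex, and the least cost is 0, 1, 2, 1
  -- in the four cases. For n = 4(k + 1) the word has length 3 + 4k, hence the split on `k`.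
  case₀ : ∀ k → n ≡ 4 * k → Nesp (Path n) ≡ 1
  case₀ zero    e = contradiction e (m<n⇒n≢0 2≤n)
  case₀ (suc k) e =
    trans (Nesp-Path {δ = 0} (trans e (*-comm 4 (suc k))) (λ ()) (subst (0 <_) (sym a₃) z<s)) a₃
    where
    a₃ = proj₂ (proj₂ (proj₂ (words-A0 k)))
  case₁ : n ≡ 4 * k + 1 → Nesp (Path n) ≡ 2 * k + 1
  case₁ e = trans
    (Nesp-Path {δ = 1} (reorder 1 e) (λ { (s≤s z≤n) → a₀ }) (subst (0 <_) (sym b₀) (m≤n+m 1 (2 * k))))
    b₀
    where
    a₀ = proj₁ (words-A0 k)
    b₀ = proj₁ (words-A1 k)
  case₂ : n ≡ 4 * k + 2 → 2 * Nesp (Path n) ≡ 5 * k ^ 2 + 5 * k + 2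
  case₂ e = trans
    (cong (2 *_) (Nesp-Path {δ = 2} (reorder 2 e) none (positive (words-A2 k))))
    (words-A2 k)
    where
    none : ∀ {d} → d < 2 → words A (1 + k * 4) d ≡ 0
    none {0} _ = proj₁ (proj₂ (words-A0 k))
    none {1} _ = proj₁ (proj₂ (words-A1 k))
    none {suc (suc _)} (s≤s (s≤s ()))
    -- The constant term 2 of the doubled formula already shows that a word of cost 2 exists.
    positive : ∀ {c x} → 2 * c ≡ x + 2 → 0 < c
    positive {zero} {x} e with () ← trans e (+-comm x 2)
    positive {suc c} _ = z<s
  case₃ : n ≡ 4 * k + 3 → Nesp (Path n) ≡ k + 1
  case₃ e = trans
    (Nesp-Path {δ = 1} (reorder 3 e) (λ { (s≤s z≤n) → a₂ }) (subst (0 <_) (sym b₂) (m≤n+m 1 k)))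
    b₂
    where
    a₂ = proj₁ (proj₂ (proj₂ (words-A0 k)))
    b₂ = proj₂ (proj₂ (words-A1 k))
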